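{- Let $R$ be one of the chain rings $\mathbb{G}_4=\mathbb{Z}_4[X]/(X^2+X+1)$, $\mathbb{S}_4=\mathbb{F}_4[X]/(X^2)$, $\mathbb{T}_4=\mathbb{F}_4[X;a\mapsto a^2]/(X^2)$. Then there exist projective arcs with parameters $(120,8)$, $(140,9)$ and $(152,10)$ in $\mathrm{PHG}(2,R)$.
   Context: $\mathbb{F}_4[X;a\mapsto a^2]$ denotes the skew polynomial ring with commutation rule $Xa=a^2X$. For a finite chain ring $R$ of length $2$ with residue field $\mathbb{F}_q$, the projective Hjelmslev plane $\mathrm{PHG}(2,R)$ is the incidence structure whose points are the free rank-$1$ submodules of the right module $R_R^3$, whose lines are the free rank-$2$ submodules of $R_R^3$, with incidence given by inclusion. A projective $(k,n)$-arc is a set of $k$ points meeting every line in at most $n$ points. -}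

module Defs where

open import Algebra.Bundles using (AbelianGroup; CommutativeRing; Ring)
import Algebra.Construct.DirectProduct as DirectProduct
import Algebra.Construct.Pointwise as Pointwise
open import Algebra.Module.Bundles using (RightModule)
open import Algebra.Morphism.Structures using (IsRingHomomorphism)
import Algebra.Properties.Group as GroupProperties
import Algebra.Properties.Monoid.Sum as MonoidSum
import Algebra.Properties.Ring as RingProperties
import Algebra.Solver.Ring.NaturalCoefficients.Default as Solver
open import Data.Bool.Properties using (xor-∧-commutativeRing; xor-same)
open import Data.Fin.Base using (Fin; toℕ)
open import Data.Fin.Patterns using (0F; 1F)
open import Data.Fin.Properties using (all?; _≟_)
open import Data.Fin.Subset using (Subset; ∣_∣; _∈_)
import Data.Nat.Base as ℕ
open import Data.Nat.Base using (ℕ; _≤_)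
open import Data.Nat.DivMod using (_mod_)
open import Data.Product.Base using (Σ; ∃; _×_; _,_)
open import Data.Vec.Functional using (Vector)
open import Function.Base using (id)
open import Function.Definitions using (Injective)
open import Level using (Level; 0ℓ; _⊔_) renaming (suc to lsuc)
open import Relation.Binary.PropositionalEquality.Core as ≡ using (_≡_; cong; cong₂)
import Relation.Binary.PropositionalEquality.Properties as ≡
import Relation.Binary.Reasoning.Setoid as SetoidReasoning
open import Relation.Nullary.Decidable.Core using (from-yes)
open import Relation.Unary using (Pred; _⊆_)

private
  variable
    c ℓ m ℓm : Level

-- In the skew polynomial ring A[X;σ], with X a = σ(a) X, put
-- f = X² + pX + q.  The last four fields say X f = f X and
-- f a = σ²(a) f for a in A, so that the left ideal generated by f is
-- two-sided.
record NormalQuadratic (A : CommutativeRing c ℓ) : Set (c ⊔ ℓ) where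
  open CommutativeRing A
  field
    σ                    : Carrier → Carrier
    σ-isRingHomomorphism : IsRingHomomorphism rawRing rawRing σ
    p q                  : Carrier
    σp≈p                 : σ p ≈ p
    σq≈q                 : σ q ≈ q
    σσa*p≈p*σa           : ∀ a → σ (σ a) * p ≈ p * σ a
    σσa*q≈q*a            : ∀ a → σ (σ a) * q ≈ q * a

-- As f is monic, every class modulo f contains exactly one polynomial
-- a + bX, represented here by the pair (a , b).  The product is
--   (a + bX)(c + dX) = ac + (ad + bσ(c))X + bσ(d)X²
-- reduced with X² = rX + s, where r = - p and s = - q.
module SkewQuotient {c ℓ} (A : CommutativeRing c ℓ) (f : NormalQuadratic A) where

  open CommutativeRing A
  open NormalQuadratic f
  private
    module σ = IsRingHomomorphism σ-isRingHomomorphism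
    open RingProperties ring using (-‿distribˡ-*; -‿distribʳ-*)
    open Solver commutativeSemiring using (solve) renaming (_:=_ to _⊜_; _:+_ to _⊕_; _:*_ to _⊗_)
    open SetoidReasoning setoid
    module +² = AbelianGroup (DirectProduct.abelianGroup +-abelianGroup +-abelianGroup)

    r s : Carrier
    r = - p
    s = - q

  infixl 7 _*²_

  _*²_ : Carrier × Carrier → Carrier × Carrier → Carrier × Carrier
  (a , b) *² (c , d) =
    a * c + b * σ d * s , a * d + b * σ c + b * σ d * r

  ι : Carrier → Carrier × Carrier
  ι a = a , 0#

  X : Carrier × Carrier
  X = 0# , 1#

  private
    σr≈r : σ r ≈ r
    σr≈r = trans (σ.-‿homo p) (-‿cong σp≈p)

    σs≈s : σ s ≈ s
    σs≈s = trans (σ.-‿homo q) (-‿cong σq≈q)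

    σσ-r : ∀ a → σ (σ a) * r ≈ r * σ a
    σσ-r a = trans (sym (-‿distribʳ-* _ _)) (trans (-‿cong (σσa*p≈p*σa a)) (-‿distribˡ-* _ _))

    σσ-s : ∀ a → σ (σ a) * s ≈ s * a
    σσ-s a = trans (sym (-‿distribʳ-* _ _)) (trans (-‿cong (σσa*q≈q*a a)) (-‿distribˡ-* _ _))

    *²-cong : ∀ {x x′ y y′} → x +².≈ x′ → y +².≈ y′ → (x *² y) +².≈ (x′ *² y′)
    *²-cong (a , b) (c , d) =
      +-cong (*-cong a c) (*-congʳ (*-cong b (σ.⟦⟧-cong d))) ,
      +-cong (+-cong (*-cong a d) (*-cong b (σ.⟦⟧-cong c))) (*-congʳ (*-cong b (σ.⟦⟧-cong d)))

    *²-assoc : ∀ x y z → ((x *² y) *² z) +².≈ (x *² (y *² z))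
    *²-assoc (a , b) (c , d) (e , g) = fst , snd
      where
      σ₁ : σ (c * e + d * σ g * s) ≈ σ c * σ e + σ d * (s * g)
      σ₁ = begin
        σ (c * e + d * σ g * s)              ≈⟨ σ.+-homo _ _ ⟩
        σ (c * e) + σ (d * σ g * s)          ≈⟨ +-cong (σ.*-homo _ _) (trans (σ.*-homo _ _) (*-cong (σ.*-homo _ _) σs≈s)) ⟩
        σ c * σ e + σ d * σ (σ g) * s        ≈⟨ +-congˡ (trans (*-assoc _ _ _) (*-congˡ (σσ-s g))) ⟩
        σ c * σ e + σ d * (s * g)            ∎

      σ₂ : σ (c * g + d * σ e + d * σ g * r) ≈ σ c * σ g + σ d * σ (σ e) + σ d * (r * σ g)
      σ₂ = begin
        σ (c * g + d * σ e + d * σ g * r)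
          ≈⟨ trans (σ.+-homo _ _) (+-congʳ (σ.+-homo _ _)) ⟩
        σ (c * g) + σ (d * σ e) + σ (d * σ g * r)
          ≈⟨ +-cong (+-cong (σ.*-homo _ _) (σ.*-homo _ _)) (trans (σ.*-homo _ _) (*-cong (σ.*-homo _ _) σr≈r)) ⟩
        σ c * σ g + σ d * σ (σ e) + σ d * σ (σ g) * r
          ≈⟨ +-congˡ (trans (*-assoc _ _ _) (*-congˡ (σσ-r g))) ⟩
        σ c * σ g + σ d * σ (σ e) + σ d * (r * σ g) ∎

      σ₂-s : b * σ (c * g + d * σ e + d * σ g * r) * s ≈
             b * σ c * σ g * s + b * σ d * (s * e) + b * σ d * (r * σ g) * s
      σ₂-s = begin
        b * σ (c * g + d * σ e + d * σ g * r) * s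
          ≈⟨ *-congʳ (*-congˡ σ₂) ⟩
        b * (σ c * σ g + σ d * σ (σ e) + σ d * (r * σ g)) * s
          ≈⟨ solve 7 (λ b c d g e r s → b ⊗ (c ⊗ g ⊕ d ⊗ e ⊕ d ⊗ (r ⊗ g)) ⊗ s ⊜
               (b ⊗ c ⊗ g ⊗ s ⊕ b ⊗ d ⊗ (e ⊗ s) ⊕ b ⊗ d ⊗ (r ⊗ g) ⊗ s))
               refl b (σ c) (σ d) (σ g) (σ (σ e)) r s ⟩
        b * σ c * σ g * s + b * σ d * (σ (σ e) * s) + b * σ d * (r * σ g) * s
          ≈⟨ +-congʳ (+-congˡ (*-congˡ (σσ-s e))) ⟩
        b * σ c * σ g * s + b * σ d * (s * e) + b * σ d * (r * σ g) * s ∎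

      σ₂-r : b * σ (c * g + d * σ e + d * σ g * r) * r ≈
             b * σ c * σ g * r + b * σ d * (r * σ e) + b * σ d * (r * σ g) * r
      σ₂-r = begin
        b * σ (c * g + d * σ e + d * σ g * r) * r
          ≈⟨ *-congʳ (*-congˡ σ₂) ⟩
        b * (σ c * σ g + σ d * σ (σ e) + σ d * (r * σ g)) * r
          ≈⟨ solve 6 (λ b c d g e r → b ⊗ (c ⊗ g ⊕ d ⊗ e ⊕ d ⊗ (r ⊗ g)) ⊗ r ⊜
               (b ⊗ c ⊗ g ⊗ r ⊕ b ⊗ d ⊗ (e ⊗ r) ⊕ b ⊗ d ⊗ (r ⊗ g) ⊗ r))
               refl b (σ c) (σ d) (σ g) (σ (σ e)) r ⟩
        b * σ c * σ g * r + b * σ d * (σ (σ e) * r) + b * σ d * (r * σ g) * r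
          ≈⟨ +-congʳ (+-congˡ (*-congˡ (σσ-r e))) ⟩
        b * σ c * σ g * r + b * σ d * (r * σ e) + b * σ d * (r * σ g) * r ∎

      fst : (a * c + b * σ d * s) * e + (a * d + b * σ c + b * σ d * r) * σ g * s ≈
            a * (c * e + d * σ g * s) + b * σ (c * g + d * σ e + d * σ g * r) * s
      fst = begin
        (a * c + b * σ d * s) * e + (a * d + b * σ c + b * σ d * r) * σ g * s
          ≈⟨ solve 10 (λ a b c d e σc σd σg r s →
               ((a ⊗ c ⊕ b ⊗ σd ⊗ s) ⊗ e ⊕ (a ⊗ d ⊕ b ⊗ σc ⊕ b ⊗ σd ⊗ r) ⊗ σg ⊗ s) ⊜
               (a ⊗ (c ⊗ e ⊕ d ⊗ σg ⊗ s) ⊕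
                 (b ⊗ σc ⊗ σg ⊗ s ⊕ b ⊗ σd ⊗ (s ⊗ e) ⊕ b ⊗ σd ⊗ (r ⊗ σg) ⊗ s)))
               refl a b c d e (σ c) (σ d) (σ g) r s ⟩
        a * (c * e + d * σ g * s) +
          (b * σ c * σ g * s + b * σ d * (s * e) + b * σ d * (r * σ g) * s)
          ≈⟨ +-congˡ σ₂-s ⟨
        a * (c * e + d * σ g * s) + b * σ (c * g + d * σ e + d * σ g * r) * s ∎

      snd : (a * c + b * σ d * s) * g + (a * d + b * σ c + b * σ d * r) * σ e +
              (a * d + b * σ c + b * σ d * r) * σ g * r ≈
            a * (c * g + d * σ e + d * σ g * r) + b * σ (c * e + d * σ g * s) +
              b * σ (c * g + d * σ e + d * σ g * r) * r
      snd = begin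
        (a * c + b * σ d * s) * g + (a * d + b * σ c + b * σ d * r) * σ e +
          (a * d + b * σ c + b * σ d * r) * σ g * r
          ≈⟨ solve 11 (λ a b c d g σc σd σe σg r s →
               ((a ⊗ c ⊕ b ⊗ σd ⊗ s) ⊗ g ⊕ (a ⊗ d ⊕ b ⊗ σc ⊕ b ⊗ σd ⊗ r) ⊗ σe ⊕
                 (a ⊗ d ⊕ b ⊗ σc ⊕ b ⊗ σd ⊗ r) ⊗ σg ⊗ r) ⊜
               (a ⊗ (c ⊗ g ⊕ d ⊗ σe ⊕ d ⊗ σg ⊗ r) ⊕ b ⊗ (σc ⊗ σe ⊕ σd ⊗ (s ⊗ g)) ⊕
                 (b ⊗ σc ⊗ σg ⊗ r ⊕ b ⊗ σd ⊗ (r ⊗ σe) ⊕ b ⊗ σd ⊗ (r ⊗ σg) ⊗ r)))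
               refl a b c d g (σ c) (σ d) (σ e) (σ g) r s ⟩
        a * (c * g + d * σ e + d * σ g * r) + b * (σ c * σ e + σ d * (s * g)) +
          (b * σ c * σ g * r + b * σ d * (r * σ e) + b * σ d * (r * σ g) * r)
          ≈⟨ +-cong (+-congˡ (*-congˡ σ₁)) σ₂-r ⟨
        a * (c * g + d * σ e + d * σ g * r) + b * σ (c * e + d * σ g * s) +
          b * σ (c * g + d * σ e + d * σ g * r) * r ∎

    0*a*b : ∀ a b → 0# * a * b ≈ 0#
    0*a*b a b = trans (*-congʳ (zeroˡ a)) (zeroˡ b)

    a*σ0*b : ∀ a b → a * σ 0# * b ≈ 0#
    a*σ0*b a b = trans (*-congʳ (trans (*-congˡ σ.0#-homo) (zeroʳ a))) (zeroˡ b)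

    drop : ∀ {a b} → b ≈ 0# → a + b ≈ a
    drop b≈0 = trans (+-congˡ b≈0) (+-identityʳ _)

    *²-identityˡ : ∀ x → (ι 1# *² x) +².≈ x
    *²-identityˡ (a , b) =
      trans (drop (0*a*b _ _)) (*-identityˡ a) ,
      trans (drop (0*a*b _ _)) (trans (drop (zeroˡ _)) (*-identityˡ b))

    *²-identityʳ : ∀ x → (x *² ι 1#) +².≈ x
    *²-identityʳ (a , b) =
      trans (drop (a*σ0*b _ _)) (*-identityʳ a) ,
      (begin
        a * 0# + b * σ 1# + b * σ 0# * r ≈⟨ drop (a*σ0*b _ _) ⟩
        a * 0# + b * σ 1#                ≈⟨ +-cong (zeroʳ a) (*-congˡ σ.1#-homo) ⟩
        0# + b * 1#                      ≈⟨ +-identityˡ _ ⟩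
        b * 1#                           ≈⟨ *-identityʳ b ⟩
        b                                ∎)

    *²-distribˡ : ∀ x y z → (x *² (y +².∙ z)) +².≈ ((x *² y) +².∙ (x *² z))
    *²-distribˡ (a , b) (c , d) (e , g) =
      trans (+-congˡ (*-congʳ (*-congˡ (σ.+-homo d g))))
        (solve 7 (λ a b c e σd σg s →
          (a ⊗ (c ⊕ e) ⊕ b ⊗ (σd ⊕ σg) ⊗ s) ⊜
          (a ⊗ c ⊕ b ⊗ σd ⊗ s ⊕ (a ⊗ e ⊕ b ⊗ σg ⊗ s)))
          refl a b c e (σ d) (σ g) s) ,
      trans (+-cong (+-congˡ (*-congˡ (σ.+-homo c e))) (*-congʳ (*-congˡ (σ.+-homo d g))))
        (solve 9 (λ a b d g σc σe σd σg r →
          (a ⊗ (d ⊕ g) ⊕ b ⊗ (σc ⊕ σe) ⊕ b ⊗ (σd ⊕ σg) ⊗ r) ⊜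
          (a ⊗ d ⊕ b ⊗ σc ⊕ b ⊗ σd ⊗ r ⊕ (a ⊗ g ⊕ b ⊗ σe ⊕ b ⊗ σg ⊗ r)))
          refl a b d g (σ c) (σ e) (σ d) (σ g) r)

    *²-distribʳ : ∀ x y z → ((y +².∙ z) *² x) +².≈ ((y *² x) +².∙ (z *² x))
    *²-distribʳ (a , b) (c , d) (e , g) =
      solve 7 (λ a c d e g σb s →
        ((c ⊕ e) ⊗ a ⊕ (d ⊕ g) ⊗ σb ⊗ s) ⊜
        (c ⊗ a ⊕ d ⊗ σb ⊗ s ⊕ (e ⊗ a ⊕ g ⊗ σb ⊗ s)))
        refl a c d e g (σ b) s ,
      solve 8 (λ b c d e g σa σb r →
        ((c ⊕ e) ⊗ b ⊕ (d ⊕ g) ⊗ σa ⊕ (d ⊕ g) ⊗ σb ⊗ r) ⊜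
        (c ⊗ b ⊕ d ⊗ σa ⊕ d ⊗ σb ⊗ r ⊕ (e ⊗ b ⊕ g ⊗ σa ⊕ g ⊗ σb ⊗ r)))
        refl b c d e g (σ a) (σ b) r

  quotientRing : Ring c ℓ
  quotientRing = record
    { _≈_    = +²._≈_
    ; _+_    = +²._∙_
    ; _*_    = _*²_
    ; -_     = +²._⁻¹
    ; 0#     = +².ε
    ; 1#     = ι 1#
    ; isRing = record
      { +-isAbelianGroup = +².isAbelianGroup
      ; *-cong           = *²-cong
      ; *-assoc          = *²-assoc
      ; *-identity       = *²-identityˡ , *²-identityʳ
      ; distrib          = *²-distribˡ , *²-distribʳ
      }
    }

  private
    module Q = Ring quotientRing

  X*a≈σa*X : ∀ a → X Q.* ι a Q.≈ ι (σ a) Q.* X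
  X*a≈σa*X a =
    (begin
      0# * a + 1# * σ 0# * s         ≈⟨ drop (a*σ0*b _ _) ⟩
      0# * a                         ≈⟨ zeroˡ a ⟩
      0#                             ≈⟨ zeroʳ (σ a) ⟨
      σ a * 0#                       ≈⟨ drop (0*a*b _ _) ⟨
      σ a * 0# + 0# * σ 1# * s       ∎) ,
    (begin
      0# * 0# + 1# * σ a + 1# * σ 0# * r ≈⟨ drop (a*σ0*b _ _) ⟩
      0# * 0# + 1# * σ a                 ≈⟨ +-cong (zeroˡ 0#) (*-comm 1# (σ a)) ⟩
      0# + σ a * 1#                      ≈⟨ +-comm _ _ ⟩
      σ a * 1# + 0#                      ≈⟨ +-congˡ (zeroˡ _) ⟨
      σ a * 1# + 0# * σ 0#               ≈⟨ drop (0*a*b _ _) ⟨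
      σ a * 1# + 0# * σ 0# + 0# * σ 1# * r ∎)

  a+b*X≈[a,b] : ∀ a b → ι a Q.+ ι b Q.* X Q.≈ (a , b)
  a+b*X≈[a,b] a b =
    trans (+-congˡ (trans (drop (0*a*b _ _)) (zeroʳ b))) (+-identityʳ a) ,
    trans (+-identityˡ _) (trans (drop (0*a*b _ _)) (trans (drop (zeroˡ _)) (*-identityʳ b)))

  X*X+p*X+q≈0 : X Q.* X Q.+ ι p Q.* X Q.+ ι q Q.≈ Q.0#
  X*X+p*X+q≈0 = Q.trans (Q.+-congʳ (Q.+-congʳ X*X≈[s,r]))
    ( Q.trans (Q.+-assoc _ _ _)
        (Q.trans (Q.+-congˡ (Q.trans (Q.+-comm _ _) (a+b*X≈[a,b] q p)))
          (-‿inverseˡ q , -‿inverseˡ p)))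
    where
    1*σ1*a : ∀ a → 1# * σ 1# * a ≈ a
    1*σ1*a a = trans (*-congʳ (trans (*-identityˡ _) σ.1#-homo)) (*-identityˡ a)

    X*X≈[s,r] : X Q.* X Q.≈ (s , r)
    X*X≈[s,r] =
      trans (+-cong (zeroˡ 0#) (1*σ1*a s)) (+-identityˡ s) ,
      trans (+-cong (trans (drop (trans (*-congˡ σ.0#-homo) (zeroʳ 1#))) (zeroˡ 1#)) (1*σ1*a r))
        (+-identityˡ r)

  quotientCommutativeRing : (∀ a → σ a ≈ a) → CommutativeRing c ℓ
  quotientCommutativeRing σa≈a = record
    { isCommutativeRing = record
      { isRing = Q.isRing
      ; *-comm = λ where
          (a , b) (c , d) →
            +-cong (*-comm a c) (*-congʳ (swap b d)) ,
            +-cong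
              (trans (+-cong (*-comm a d) (trans (*-congˡ (σa≈a c)) (*-comm b c)))
                (trans (+-comm _ _) (+-congˡ (*-congˡ (sym (σa≈a a))))))
              (*-congʳ (swap b d))
      }
    }
    where
    swap : ∀ b d → b * σ d ≈ d * σ b
    swap b d = trans (*-congˡ (σa≈a d)) (trans (*-comm b d) (*-congˡ (sym (σa≈a b))))

quadratic : (A : CommutativeRing c ℓ) (p q : CommutativeRing.Carrier A) → NormalQuadratic A
quadratic A p q = record
  { σ                    = id
  ; σ-isRingHomomorphism = record
    { isSemiringHomomorphism = record
      { isNearSemiringHomomorphism = record
        { +-isMonoidHomomorphism = record
          { isMagmaHomomorphism = record
            { isRelHomomorphism = record { cong = id }
            ; homo              = λ _ _ → refl
            }
          ; ε-homo = refl
          }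
        ; *-homo = λ _ _ → refl
        }
      ; 1#-homo = refl
      }
    ; -‿homo = λ _ → refl
    }
  ; p          = p
  ; q          = q
  ; σp≈p       = refl
  ; σq≈q       = refl
  ; σσa*p≈p*σa = λ a → *-comm a p
  ; σσa*q≈q*a  = λ a → *-comm a q
  }
  where open CommutativeRing A

_[X]/⟨X²+_X+_⟩ : (A : CommutativeRing c ℓ) (p q : CommutativeRing.Carrier A) → CommutativeRing c ℓ
A [X]/⟨X²+ p X+ q ⟩ = SkewQuotient.quotientCommutativeRing A (quadratic A p q)
  (λ _ → CommutativeRing.refl A)

ℤ₄ : CommutativeRing 0ℓ 0ℓ
ℤ₄ = record
  { Carrier = Fin 4
  ; _≈_     = _≡_
  ; _+_     = _+₄_
  ; _*_     = _*₄_
  ; -_      = -₄_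
  ; 0#      = 0F
  ; 1#      = 1F
  ; isCommutativeRing = record
    { isRing = record
      { +-isAbelianGroup = record
        { isGroup = record
          { isMonoid = record
            { isSemigroup = record
              { isMagma = record
                { isEquivalence = ≡.isEquivalence
                ; ∙-cong        = cong₂ _+₄_
                }
              ; assoc = from-yes (all? λ a → all? λ b → all? λ c →
                          ((a +₄ b) +₄ c) ≟ (a +₄ (b +₄ c)))
              }
            ; identity = from-yes (all? λ a → (0F +₄ a) ≟ a)
                       , from-yes (all? λ a → (a +₄ 0F) ≟ a)
            }
          ; inverse = from-yes (all? λ a → ((-₄ a) +₄ a) ≟ 0F)
                    , from-yes (all? λ a → (a +₄ (-₄ a)) ≟ 0F)
          ; ⁻¹-cong = cong -₄_
          }
        ; comm = from-yes (all? λ a → all? λ b → (a +₄ b) ≟ (b +₄ a))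
        }
      ; *-cong     = cong₂ _*₄_
      ; *-assoc    = from-yes (all? λ a → all? λ b → all? λ c →
                       ((a *₄ b) *₄ c) ≟ (a *₄ (b *₄ c)))
      ; *-identity = from-yes (all? λ a → (1F *₄ a) ≟ a)
                   , from-yes (all? λ a → (a *₄ 1F) ≟ a)
      ; distrib    = from-yes (all? λ a → all? λ b → all? λ c →
                       (a *₄ (b +₄ c)) ≟ ((a *₄ b) +₄ (a *₄ c)))
                   , from-yes (all? λ a → all? λ b → all? λ c →
                       ((b +₄ c) *₄ a) ≟ ((b *₄ a) +₄ (c *₄ a)))
      }
    ; *-comm = from-yes (all? λ a → all? λ b → (a *₄ b) ≟ (b *₄ a))
    }
  }
  where
  _+₄_ _*₄_ : Fin 4 → Fin 4 → Fin 4
  a +₄ b = (toℕ a ℕ.+ toℕ b) mod 4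
  a *₄ b = (toℕ a ℕ.* toℕ b) mod 4

  -₄_ : Fin 4 → Fin 4
  -₄ a = (4 ℕ.∸ toℕ a) mod 4

𝔽₂ : CommutativeRing 0ℓ 0ℓ
𝔽₂ = xor-∧-commutativeRing

𝔽₄ : CommutativeRing 0ℓ 0ℓ
𝔽₄ = 𝔽₂ [X]/⟨X²+ 1# X+ 1# ⟩
  where open CommutativeRing 𝔽₂

squaring-isRingHomomorphism : (A : CommutativeRing c ℓ) → let open CommutativeRing A in
  (∀ a → a + a ≈ 0#) → IsRingHomomorphism rawRing rawRing (λ a → a * a)
squaring-isRingHomomorphism A a+a≈0 = record
  { isSemiringHomomorphism = record
    { isNearSemiringHomomorphism = record
      { +-isMonoidHomomorphism = record
        { isMagmaHomomorphism = record
          { isRelHomomorphism = record { cong = λ a≈b → *-cong a≈b a≈b }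
          ; homo              = λ a b → trans
              (solve 2 (λ a b → ((a ⊕ b) ⊗ (a ⊕ b)) ⊜ (a ⊗ a ⊕ b ⊗ b ⊕ (a ⊗ b ⊕ a ⊗ b))) refl a b)
              (trans (+-congˡ (a+a≈0 (a * b))) (+-identityʳ _))
          }
        ; ε-homo = zeroˡ 0#
        }
      ; *-homo = λ a b → solve 2 (λ a b → (a ⊗ b ⊗ (a ⊗ b)) ⊜ (a ⊗ a ⊗ (b ⊗ b))) refl a b
      }
    ; 1#-homo = *-identityˡ 1#
    }
  ; -‿homo = λ a → trans (sym (*-cong (a≈-a a) (a≈-a a))) (a≈-a (a * a))
  }
  where
  open CommutativeRing A
  open Solver commutativeSemiring using (solve) renaming (_:=_ to _⊜_; _:+_ to _⊕_; _:*_ to _⊗_)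

  a≈-a : ∀ a → a ≈ - a
  a≈-a a = inverseˡ-unique a a (a+a≈0 a)
    where open GroupProperties +-group using (inverseˡ-unique)

frobeniusX² : NormalQuadratic 𝔽₄
frobeniusX² = record
  { σ                    = λ a → a * a
  ; σ-isRingHomomorphism = squaring-isRingHomomorphism 𝔽₄ (λ (a , b) → xor-same a , xor-same b)
  ; p                    = 0#
  ; q                    = 0#
  ; σp≈p                 = ≡.refl , ≡.refl
  ; σq≈q                 = ≡.refl , ≡.refl
  ; σσa*p≈p*σa           = λ a → *-comm ((a * a) * (a * a)) 0#
  ; σσa*q≈q*a            = λ a → trans {j = 0#} (zeroʳ ((a * a) * (a * a))) (sym {0# * a} (zeroˡ a))
  }
  where open CommutativeRing 𝔽₄

𝔾₄ 𝕊₄ 𝕋₄ : Ring 0ℓ 0ℓ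
𝔾₄ = CommutativeRing.ring (ℤ₄ [X]/⟨X²+ 1# X+ 1# ⟩)
  where open CommutativeRing ℤ₄
𝕊₄ = CommutativeRing.ring (𝔽₄ [X]/⟨X²+ 0# X+ 0# ⟩)
  where open CommutativeRing 𝔽₄
𝕋₄ = SkewQuotient.quotientRing 𝔽₄ frobeniusX²

record Submodule {R : Ring c ℓ} (M : RightModule R m ℓm) (p : Level) :
                 Set (c ⊔ m ⊔ ℓm ⊔ lsuc p) where
  open Ring R using (Carrier)
  open RightModule M
  field
    Mem       : Pred Carrierᴹ p
    resp      : ∀ {x y} → x ≈ᴹ y → Mem x → Mem y
    0-closed  : Mem 0ᴹ
    +-closed  : ∀ {x y} → Mem x → Mem y → Mem (x +ᴹ y)
    *ᵣ-closed : ∀ {x} → Mem x → (a : Carrier) → Mem (x *ᵣ a)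

module _ {c ℓ m ℓm p : Level} {R : Ring c ℓ} {M : RightModule R m ℓm} where
  open Ring R using (Carrier; _≈_; 0#)
  open RightModule M
  open MonoidSum +ᴹ-monoid using (sum)

  record IsBasis (N : Submodule M p) {n : ℕ} (b : Vector Carrierᴹ n) :
                 Set (c ⊔ ℓ ⊔ m ⊔ ℓm ⊔ p) where
    field
      member      : ∀ i → Submodule.Mem N (b i)
      spanning    : ∀ {x} → Submodule.Mem N x →
                    ∃ λ (a : Vector Carrier n) → x ≈ᴹ sum (λ i → b i *ᵣ a i)
      independent : (a : Vector Carrier n) → sum (λ i → b i *ᵣ a i) ≈ᴹ 0ᴹ →
                    ∀ i → a i ≈ 0#

  IsFreeOfRank : ℕ → Submodule M p → Set (c ⊔ ℓ ⊔ m ⊔ ℓm ⊔ p)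
  IsFreeOfRank n N = ∃ λ (b : Vector Carrierᴹ n) → IsBasis N b

freeRightModule : (R : Ring c ℓ) → ℕ → RightModule R c ℓ
freeRightModule R n = record
  { Carrierᴹ = Vector Carrier n
  ; _≈ᴹ_ = λ x y → ∀ i → x i ≈ y i
  ; _+ᴹ_ = λ x y i → x i + y i
  ; _*ᵣ_ = λ x a i → x i * a
  ; 0ᴹ   = λ _ → 0#
  ; -ᴹ_  = λ x i → - x i
  ; isRightModule = record
    { isRightSemimodule = record
      { +ᴹ-isCommutativeMonoid = Pointwise.isCommutativeMonoid (Fin n) +-isCommutativeMonoid
      ; isPrerightSemimodule = record
        { *ᵣ-cong      = λ x≈y a≈b i → *-cong (x≈y i) a≈b
        ; *ᵣ-zeroʳ     = λ x i → zeroʳ (x i)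
        ; *ᵣ-distribˡ  = λ x a b i → distribˡ (x i) a b
        ; *ᵣ-identityʳ = λ x i → *-identityʳ (x i)
        ; *ᵣ-assoc     = λ x a b i → *-assoc (x i) a b
        ; *ᵣ-zeroˡ     = λ a i → zeroˡ a
        ; *ᵣ-distribʳ  = λ a x y i → distribʳ a (x i) (y i)
        }
      }
    ; -ᴹ‿cong    = λ x≈y i → -‿cong (x≈y i)
    ; -ᴹ‿inverse = (λ x i → -‿inverseˡ (x i)) , (λ x i → -‿inverseʳ (x i))
    }
  }
  where open Ring R

module PHG {c ℓ} (R : Ring c ℓ) where

  FreeSubmodule : ℕ → Set (lsuc (c ⊔ ℓ))
  FreeSubmodule n = Σ (Submodule (freeRightModule R 3) (c ⊔ ℓ)) (IsFreeOfRank n)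

  Point Line : Set (lsuc (c ⊔ ℓ))
  Point = FreeSubmodule 1
  Line  = FreeSubmodule 2

  infix 4 _≈ₚ_ _I_

  _≈ₚ_ : Point → Point → Set (c ⊔ ℓ)
  (P , _) ≈ₚ (Q , _) = Submodule.Mem P ⊆ Submodule.Mem Q × Submodule.Mem Q ⊆ Submodule.Mem P

  _I_ : Point → Line → Set (c ⊔ ℓ)
  (P , _) I (L , _) = Submodule.Mem P ⊆ Submodule.Mem L

  -- A set of k points is an injective enumeration by Fin k.  That a
  -- line carries at most n of them is expressed by bounding the size of
  -- every subset of the enumeration that is contained in the line.
  record ProjectiveArc (k n : ℕ) : Set (lsuc (c ⊔ ℓ)) where
    field
      points   : Fin k → Point
      distinct : Injective _≡_ _≈ₚ_ points
      bounded  : (L : Line) (S : Subset k) → (∀ {i} → i ∈ S → points i I L) → ∣ S ∣ ≤ n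

{-# OPTIONS --safe #-}
module Submission where

-- Over a chain ring Gaussian elimination never gets stuck, since of two entries
-- one divides the other; hence any m vectors of R^(m+1) are killed by a left
-- linear form with a unit coordinate, and every line lies in the kernel of such
-- a form.  Scaling the first unit coordinate to 1 leaves 336 forms, and likewise
-- the points correspond to the 336 column vectors normalised in this way.  An
-- arc is thus a set of normalised vectors of which each normalised form kills
-- at most n, which is verified by counting.

open import Algebra.Bundles using (Ring)
open import Algebra.Module.Bundles using (RightModule)
import Algebra.Properties.Monoid.Sum as MonoidSum
import Algebra.Properties.Ring as RingProperties
import Algebra.Properties.Semiring.Sum as SemiringSum
open import Data.Bool.Base using (Bool; true; false; T; if_then_else_)
open import Data.Bool.ListAction using (all)
import Data.Bool.Properties as Bool
open import Data.Fin.Base using (Fin; zero; suc; punchIn)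
open import Data.Fin.Patterns using (0F; 2F)
import Data.Fin.Properties as Fin
open import Data.Fin.Subset using (Subset; ∣_∣; _∈_; inside; outside)
open import Data.List.Base using (List; []; _∷_; _++_; allFin; cartesianProduct; cartesianProductWith; filter; filterᵇ; length; lookup; map)
open import Data.List.Membership.Propositional using (lose) renaming (_∈_ to _∈ₗ_)
open import Data.List.Membership.Propositional.Properties using (∈-++⁺ˡ; ∈-++⁺ʳ; ∈-allFin; ∈-cartesianProduct⁺; ∈-cartesianProductWith⁺; ∈-filter⁺; ∈-cartesianProductWith⁻; ∈-filter⁻; ∈-lookup; ∈-map⁺; ∈-map⁻)
open import Data.List.Relation.Binary.Disjoint.Propositional using (Disjoint)
open import Data.List.Relation.Unary.All as All using (All; []; _∷_)
import Data.List.Relation.Unary.All.Properties as All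
open import Data.List.Relation.Unary.AllPairs using ([]; _∷_)
open import Data.List.Relation.Unary.Any using (here; there; any?; satisfied)
open import Data.List.Relation.Unary.Unique.Propositional using (Unique)
import Data.List.Relation.Unary.Unique.Propositional.Properties as Unique
open import Data.Nat.Base using (ℕ; zero; suc; _≤_; z≤n; s≤s; _≤ᵇ_; _/_; _%_; _≡ᵇ_)
open import Data.Nat.Properties using (≤ᵇ⇒≤; ≡ᵇ⇒≡; ≤-trans; m≤n⇒m≤1+n)
open import Data.Product.Base using (∃; _×_; _,_; proj₁; proj₂)
open import Data.Product.Properties using (≡-dec)
open import Data.Sum.Base using (_⊎_; inj₁; inj₂)
open import Data.Vec.Base as Vec using (Vec; []; _∷_; here; there)
import Data.Vec.Functional as Functional
open import Data.Vec.Functional using (Vector; insertAt)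
open import Data.Vec.Functional.Properties using (insertAt-lookup; insertAt-punchIn)
import Data.Vec.Properties as Vec
open import Function.Base using (_∘_)
open import Function.Bundles using (module Equivalence)
open import Function.Definitions using (Injective)
open import Level using (0ℓ)
open import Relation.Binary.Definitions using (DecidableEquality)
open import Relation.Binary.PropositionalEquality.Core as ≡ using (_≡_; _≢_; refl; cong; cong₂; subst)
import Relation.Binary.PropositionalEquality.Properties as ≡
import Relation.Binary.Reasoning.Setoid as SetoidReasoning
open import Relation.Nullary.Decidable using (dec-true; map′)
open import Relation.Nullary.Decidable.Core using (Dec; yes; does; _⊎-dec_)
open import Relation.Nullary.Negation.Core using (contradiction)
open import Relation.Unary using (Decidable)
open import Defs

open Equivalence using (from)

-- Finite types and decisions by exhaustion

-- With `refl` as second argument, type checking evaluates only the boolean of the decision and not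
-- the proof that accompanies it.
witness : ∀ {A : Set} (A? : Dec A) → does A? ≡ true → A
witness (yes a) _ = a

-- Tables make the counts below feasible: during evaluation a table bound to a
-- variable is shared, so that each of its entries is computed at most once.
record Finite (A : Set) : Set₁ where
  infix 4 _≟_
  infixl 9 _!_
  field
    elements   : List A
    complete   : ∀ x → x ∈ₗ elements
    unique     : Unique elements
    _≟_        : DecidableEquality A
    Table      : Set → Set
    tabulate   : ∀ {B} → (A → B) → Table B
    _!_        : ∀ {B} → Table B → A → B
    tabulate-! : ∀ {B} (f : A → B) x → tabulate f ! x ≡ f x

  ∀? : ∀ {P : A → Set} → Decidable P → Dec (∀ x → P x)
  ∀? P? = map′ (λ ps x → All.lookup ps (complete x)) (λ p → All.universal p elements)
    (All.all? P? elements)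

  ∃? : ∀ {P : A → Set} → Decidable P → Dec (∃ P)
  ∃? P? = map′ satisfied (λ (x , px) → lose (complete x) px) (any? P? elements)

Bool-finite : Finite Bool
Bool-finite = record
  { elements   = false ∷ true ∷ []
  ; complete   = λ { false → here refl ; true → there (here refl) }
  ; unique     = ((λ ()) ∷ []) ∷ [] ∷ []
  ; _≟_        = Bool._≟_
  ; Table      = λ B → B × B
  ; tabulate   = λ f → f false , f true
  ; _!_        = λ { (x , y) false → x ; (x , y) true → y }
  ; tabulate-! = λ { f false → refl ; f true → refl }
  }

Fin-finite : ∀ n → Finite (Fin n)
Fin-finite n = record
  { elements   = allFin n
  ; complete   = ∈-allFin
  ; unique     = Unique.allFin⁺ n
  ; _≟_        = Fin._≟_
  ; Table      = λ B → Vec B n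
  ; tabulate   = Vec.tabulate
  ; _!_        = Vec.lookup
  ; tabulate-! = Vec.lookup∘tabulate
  }

infixr 2 _×-finite_

_×-finite_ : ∀ {A B} → Finite A → Finite B → Finite (A × B)
F ×-finite G = record
  { elements   = cartesianProduct F.elements G.elements
  ; complete   = λ (x , y) → ∈-cartesianProduct⁺ (F.complete x) (G.complete y)
  ; unique     = Unique.cartesianProduct⁺ F.unique G.unique
  ; _≟_        = ≡-dec F._≟_ G._≟_
  ; Table      = λ C → F.Table (G.Table C)
  ; tabulate   = λ f → F.tabulate λ x → G.tabulate λ y → f (x , y)
  ; _!_        = λ t (x , y) → (t F.! x) G.! y
  ; tabulate-! = λ f (x , y) → ≡.trans (cong (G._! y) (F.tabulate-! _ x)) (G.tabulate-! _ y)
  }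
  where
  module F = Finite F
  module G = Finite G

-- Sublists and their sizes

-- m is a bit mask, its least significant bit deciding about the head.
select : {A : Set} → ℕ → List A → List A
select m []       = []
select m (x ∷ xs) = if m % 2 ≡ᵇ 1 then x ∷ select (m / 2) xs else select (m / 2) xs

select⁺ : {A : Set} {P : A → Set} → ∀ m {xs} → All P xs → All P (select m xs)
select⁺ m []         = []
select⁺ m (px ∷ pxs) with m % 2 ≡ᵇ 1
... | true  = px ∷ select⁺ (m / 2) pxs
... | false = select⁺ (m / 2) pxs

select-unique : {A : Set} → ∀ m {xs : List A} → Unique xs → Unique (select m xs)
select-unique m []       = []
select-unique m (x∉ ∷ u) with m % 2 ≡ᵇ 1
... | true  = select⁺ (m / 2) x∉ ∷ select-unique (m / 2) u
... | false = select-unique (m / 2) u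

lookup-injective : {A : Set} {xs : List A} → Unique xs → Injective _≡_ _≡_ (lookup xs)
lookup-injective (x∉ ∷ u) {zero}  {zero}  _  = refl
lookup-injective (x∉ ∷ u) {zero}  {suc j} eq = contradiction eq (All.lookup x∉ (∈-lookup j))
lookup-injective (x∉ ∷ u) {suc i} {zero}  eq = contradiction (≡.sym eq) (All.lookup x∉ (∈-lookup i))
lookup-injective (x∉ ∷ u) {suc i} {suc j} eq = cong suc (lookup-injective u eq)

-- Replaces the bound on all subsets `S` demanded by `ProjectiveArc` by a single count over the
-- list.
∣S∣≤length-filterᵇ : {A : Set} (P : A → Bool) (xs : List A) (S : Subset (length xs)) →
  (∀ {i} → i ∈ S → P (lookup xs i) ≡ true) → ∣ S ∣ ≤ length (filterᵇ P xs)
∣S∣≤length-filterᵇ P []       []            S⊆P = z≤n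
∣S∣≤length-filterᵇ P (x ∷ xs) (inside ∷ S)  S⊆P rewrite S⊆P here =
  s≤s (∣S∣≤length-filterᵇ P xs S (S⊆P ∘ there))
∣S∣≤length-filterᵇ P (x ∷ xs) (outside ∷ S) S⊆P with P x
... | true  = m≤n⇒m≤1+n (∣S∣≤length-filterᵇ P xs S (S⊆P ∘ there))
... | false = ∣S∣≤length-filterᵇ P xs S (S⊆P ∘ there)

-- Chain rings

-- The alternatives of `unit⊎nil` exclude each other, because `b * a ≡ 1#` and `a * θ ≡ 0#` would
-- give `θ ≡ 0#`. Killing `θ` is therefore a test for having no left inverse that takes one
-- multiplication. By `chain`, any two principal left ideals are comparable under inclusion.
record IsChainRing (R : Ring 0ℓ 0ℓ) : Set where
  open Ring R
  field
    ≈⇒≡      : ∀ {x y} → x ≈ y → x ≡ y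
    θ        : Carrier
    θ≢0      : θ ≢ 0#
    unit⊎nil : ∀ a → (∃ λ b → b * a ≡ 1#) ⊎ a * θ ≡ 0#
    chain    : ∀ a b → (∃ λ c → a ≡ c * b) ⊎ (∃ λ c → b ≡ c * a)

module Arcs (R : Ring 0ℓ 0ℓ) (F : Finite (Ring.Carrier R)) (C : IsChainRing R) where
  open Ring R hiding (zero) renaming (refl to ≈-refl; sym to ≈-sym; trans to ≈-trans; reflexive to ≈-reflexive)
  open RingProperties R using (-‿distribˡ-*; -‿distribʳ-*)
  open SemiringSum semiring
  open SetoidReasoning setoid
  open IsChainRing C
  open Finite F
  open PHG R

  private
    module R³ = RightModule (freeRightModule R 3)
    open MonoidSum R³.+ᴹ-monoid using () renaming (sum to R³-sum)

  -- Left linear forms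

  sum-≈0 : ∀ {n} (f : Vector Carrier n) → (∀ i → f i ≈ 0#) → sum f ≈ 0#
  sum-≈0 {n} f f≈0 = ≈-trans (sum-cong-≋ f≈0) (sum-replicate-zero n)

  infix 8 _∙_

  _∙_ : ∀ {n} → Vector Carrier n → Vector Carrier n → Carrier
  l ∙ x = sum λ i → l i * x i

  ∙-cong : ∀ {n} {l l′ x x′ : Vector Carrier n} → (∀ i → l i ≈ l′ i) → (∀ i → x i ≈ x′ i) →
           l ∙ x ≈ l′ ∙ x′
  ∙-cong l≈ x≈ = sum-cong-≋ λ i → *-cong (l≈ i) (x≈ i)

  ∙-distribˡ : ∀ {n} (l x y : Vector Carrier n) → l ∙ (λ i → x i + y i) ≈ l ∙ x + l ∙ y
  ∙-distribˡ l x y = ≈-trans (sum-cong-≋ λ i → distribˡ (l i) (x i) (y i))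
    (∑-distrib-+ (λ i → l i * x i) (λ i → l i * y i))

  ∙-assocʳ : ∀ {n} (l x : Vector Carrier n) a → l ∙ (λ i → x i * a) ≈ l ∙ x * a
  ∙-assocʳ l x a = ≈-trans (sum-cong-≋ λ i → ≈-sym (*-assoc (l i) (x i) a))
    (≈-sym (*-distribʳ-sum a (λ i → l i * x i)))

  ∙-assocˡ : ∀ {n} u (l x : Vector Carrier n) → (λ i → u * l i) ∙ x ≈ u * l ∙ x
  ∙-assocˡ u l x = ≈-trans (sum-cong-≋ λ i → *-assoc u (l i) (x i))
    (≈-sym (*-distribˡ-sum u (λ i → l i * x i)))

  -- Elimination over a chain ring

  -- Induction on the length: the head and the pivot of the tail are comparable by `chain`, and
  -- whichever is a right divisor of the other is a right divisor of every entry.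
  pivot : ∀ {n} (x : Vector Carrier (suc n)) →
          ∃ λ p → ∃ λ (c : Vector Carrier (suc n)) → ∀ i → x i ≈ c i * x p
  pivot {zero}  x = zero , (λ _ → 1#) , λ { zero → ≈-sym (*-identityˡ _) }
  pivot {suc n} x with pivot (x ∘ suc)
  ... | p , c , x≈ with chain (x zero) (x (suc p))
  ...   | inj₁ (d , eq) = suc p , d Functional.∷ c , λ { zero → ≈-reflexive eq ; (suc i) → x≈ i }
  ...   | inj₂ (d , eq) = zero , 1# Functional.∷ (λ i → c i * d) , λ where
          zero    → ≈-sym (*-identityˡ _)
          (suc i) → ≈-trans (x≈ i) (≈-trans (*-congˡ (≈-reflexive eq)) (≈-sym (*-assoc _ _ _)))

  -- Gaussian elimination, where the chain condition supplies in each column an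
  -- entry dividing all the others.
  annihilator : ∀ m (b : Vector (Vector Carrier (suc m)) m) →
                ∃ λ l → (∃ λ i → l i ≈ 1#) × (∀ j → l ∙ b j ≈ 0#)
  annihilator zero    b = (λ _ → 1#) , (zero , ≈-refl) , λ ()
  annihilator (suc m) b
    with p , c , b₀≈ ← pivot (b zero)
    -- The map sending x to the entries `x i - c i * x p` for i other than `p` is right linear and
    -- kills `b zero`. The form `l′` annihilates the images of the other vectors, and `l` is its
    -- pullback; this forces the coordinate `v` at `p` and keeps the unit coordinate of `l′`.
    with l′ , (k , l′k≈1) , l′b≈0 ← annihilator m (λ j i →
           b (suc j) (punchIn p i) - c (punchIn p i) * b (suc j) p)
    = l , (punchIn p k , ≈-trans (≈-reflexive (insertAt-punchIn l′ p v k)) l′k≈1) , λ where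
        zero    → ≈-trans (l∙ (b zero)) (sum-≈0 _ λ i → ≈-trans
                    (*-congˡ {l′ i} (≈-trans (+-congʳ (b₀≈ (punchIn p i))) (-‿inverseʳ _))) (zeroʳ (l′ i)))
        (suc j) → ≈-trans (l∙ (b (suc j))) (l′b≈0 j)
    where
    v : Carrier
    v = sum λ i → - (l′ i * c (punchIn p i))

    l : Vector Carrier (suc (suc m))
    l = insertAt l′ p v

    step : ∀ a c x y → - (a * c) * y + a * x ≈ a * (x - c * y)
    step a c x y = begin
      - (a * c) * y + a * x   ≈⟨ +-comm _ _ ⟩
      a * x + - (a * c) * y   ≈⟨ +-congˡ (-‿distribˡ-* _ _) ⟨
      a * x - a * c * y       ≈⟨ +-congˡ (-‿cong (*-assoc a c y)) ⟩
      a * x - a * (c * y)     ≈⟨ +-congˡ (-‿distribʳ-* _ _) ⟩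
      a * x + a * - (c * y)   ≈⟨ distribˡ _ _ _ ⟨
      a * (x - c * y)         ∎

    l∙ : ∀ x → l ∙ x ≈ l′ ∙ (λ i → x (punchIn p i) - c (punchIn p i) * x p)
    l∙ x = begin
      l ∙ x
        ≈⟨ sum-remove {i = p} (λ i → l i * x i) ⟩
      l p * x p + sum (λ i → l (punchIn p i) * x (punchIn p i))
        ≈⟨ +-cong (*-congʳ (≈-reflexive (insertAt-lookup l′ p v)))
             (sum-cong-≋ λ i → *-congʳ {x (punchIn p i)} (≈-reflexive (insertAt-punchIn l′ p v i))) ⟩
      v * x p + l′ ∙ (x ∘ punchIn p)
        ≈⟨ +-congʳ (*-distribʳ-sum (x p) (λ i → - (l′ i * c (punchIn p i)))) ⟩
      sum (λ i → - (l′ i * c (punchIn p i)) * x p) + l′ ∙ (x ∘ punchIn p)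
        ≈⟨ ∑-distrib-+ (λ i → - (l′ i * c (punchIn p i)) * x p) (λ i → l′ i * x (punchIn p i)) ⟨
      sum (λ i → - (l′ i * c (punchIn p i)) * x p + l′ i * x (punchIn p i))
        ≈⟨ sum-cong-≋ (λ i → step (l′ i) (c (punchIn p i)) (x (punchIn p i)) (x p)) ⟩
      l′ ∙ (λ i → x (punchIn p i) - c (punchIn p i) * x p) ∎

  -- Normalised vectors

  ≈1⇒aθ≢0 : ∀ {a} → a ≈ 1# → a * θ ≢ 0#
  ≈1⇒aθ≢0 a≈1 aθ≡0 =
    θ≢0 (≈⇒≡ (≈-trans (≈-sym (≈-trans (*-congʳ a≈1) (*-identityˡ θ))) (≈-reflexive aθ≡0)))

  aθ≡0⇒baθ≡0 : ∀ {a} b → a * θ ≡ 0# → b * a * θ ≡ 0#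
  aθ≡0⇒baθ≡0 b aθ≡0 =
    ≈⇒≡ (≈-trans (*-assoc _ _ _) (≈-trans (*-congˡ (≈-reflexive aθ≡0)) (zeroʳ b)))

  -- The first entry that is a unit equals 1.
  data Normal : ∀ {n} → Vec Carrier n → Set where
    unit : ∀ {n} {x : Vec Carrier n} → Normal (1# ∷ x)
    nil  : ∀ {n a} {x : Vec Carrier n} → a * θ ≡ 0# → Normal x → Normal (a ∷ x)

  -- The scalar `u` is a left inverse of the first coordinate that does not kill `θ`. The
  -- coordinates before it still kill `θ` after multiplication by `u` from the left, and the
  -- coordinate 1 guarantees that the search ends.
  normalise : ∀ {n} (l : Vector Carrier n) → (∃ λ i → l i ≈ 1#) →
              ∃ λ u → Normal (Vec.tabulate (λ i → u * l i))
  normalise {suc n} l (i , li≈1) with unit⊎nil (l zero)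
  ... | inj₁ (u , ul₀≡1) = u , subst (λ a → Normal (a ∷ Vec.tabulate (λ i → u * l (suc i)))) (≡.sym ul₀≡1) unit
  normalise {suc n} l (zero  , l₀≈1) | inj₂ l₀θ≡0 = contradiction l₀θ≡0 (≈1⇒aθ≢0 l₀≈1)
  normalise {suc n} l (suc i , li≈1) | inj₂ l₀θ≡0 with normalise (l ∘ suc) (i , li≈1)
  ... | u , ul-normal = u , nil (aθ≡0⇒baθ≡0 u l₀θ≡0) ul-normal

  -- The entry 1 of `p` reproduces the scalar; this makes `p` a basis of the point it spans.
  multiple≈0⇒≈0 : ∀ {n} {p : Vec Carrier n} → Normal p → ∀ {a} →
                  (∀ i → Vec.lookup p i * a ≈ 0#) → a ≈ 0#
  multiple≈0⇒≈0 unit      pa≈0 = ≈-trans (≈-sym (*-identityˡ _)) (pa≈0 zero)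
  multiple≈0⇒≈0 (nil _ N) pa≈0 = multiple≈0⇒≈0 N (pa≈0 ∘ suc)

  -- Some entry of `p` is 1, a left multiple of `a`, so `a` cannot kill `θ`.
  normal-multiple⇒aθ≢0 : ∀ {n} {p : Vec Carrier n} → Normal p → ∀ (x : Vector Carrier n) {a} →
                         (∀ i → Vec.lookup p i ≈ x i * a) → a * θ ≢ 0#
  normal-multiple⇒aθ≢0 unit      x p≈xa aθ≡0 =
    ≈1⇒aθ≢0 (≈-sym (p≈xa zero)) (aθ≡0⇒baθ≡0 (x zero) aθ≡0)
  normal-multiple⇒aθ≢0 (nil _ N) x p≈xa      = normal-multiple⇒aθ≢0 N (x ∘ suc) (p≈xa ∘ suc)

  -- If both vectors start with 1, the heads give the scalar. If only one does, the head of the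
  -- other equals the scalar that produces it and kills `θ`, which its normalised tail forbids.
  -- Otherwise both heads are dropped.
  normal-multiple⇒≈1 : ∀ {n} {p q : Vec Carrier n} → Normal p → Normal q → ∀ {a b} →
                       (∀ i → Vec.lookup p i ≈ Vec.lookup q i * a) →
                       (∀ i → Vec.lookup q i ≈ Vec.lookup p i * b) → a ≈ 1#
  normal-multiple⇒≈1 unit unit {a} p≈qa _ =
    ≈-trans (≈-sym (*-identityˡ a)) (≈-sym (p≈qa zero))
  normal-multiple⇒≈1 unit (nil qθ≡0 N) {b = b} _ q≈pb = contradiction
    (≡.trans (cong (_* θ) (≈⇒≡ (≈-sym (≈-trans (q≈pb zero) (*-identityˡ b))))) qθ≡0)
    (normal-multiple⇒aθ≢0 N _ (q≈pb ∘ suc))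
  normal-multiple⇒≈1 (nil pθ≡0 N) unit {a} p≈qa _ = contradiction
    (≡.trans (cong (_* θ) (≈⇒≡ (≈-sym (≈-trans (p≈qa zero) (*-identityˡ a))))) pθ≡0)
    (normal-multiple⇒aθ≢0 N _ (p≈qa ∘ suc))
  normal-multiple⇒≈1 (nil _ M) (nil _ N) p≈qa q≈pb =
    normal-multiple⇒≈1 M N (p≈qa ∘ suc) (q≈pb ∘ suc)

  -- Two generators of the same point are multiples of each other, so this is what makes the points
  -- of an arc distinct.
  normal-unique : ∀ {n} {p q : Vec Carrier n} → Normal p → Normal q → ∀ {a b} →
                  (∀ i → Vec.lookup p i ≈ Vec.lookup q i * a) →
                  (∀ i → Vec.lookup q i ≈ Vec.lookup p i * b) → p ≡ q
  normal-unique {p = p} {q} M N p≈qa q≈pb =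
    ≡.trans (≡.sym (Vec.tabulate∘lookup p)) (≡.trans (Vec.tabulate-cong p≗q) (Vec.tabulate∘lookup q))
    where
    p≗q : ∀ i → Vec.lookup p i ≡ Vec.lookup q i
    p≗q i = ≈⇒≡ (≈-trans (p≈qa i)
      (≈-trans (*-congˡ (normal-multiple⇒≈1 M N p≈qa q≈pb)) (*-identityʳ _)))

  -- Enumeration of the normalised vectors

  vectors : ∀ n → List (Vec Carrier n)
  vectors zero    = [] ∷ []
  vectors (suc n) = cartesianProductWith _∷_ elements (vectors n)

  ∈-vectors : ∀ {n} (x : Vec Carrier n) → x ∈ₗ vectors n
  ∈-vectors []      = here refl
  ∈-vectors (a ∷ x) = ∈-cartesianProductWith⁺ _∷_ (complete a) (∈-vectors x)

  nils : List Carrier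
  nils = filter (λ a → a * θ ≟ 0#) elements

  -- With 16 ring elements, 4 of which kill `θ`, `normals 3` has 16² + 4 · 16 + 4² = 336 entries.
  normals : ∀ n → List (Vec Carrier n)
  normals zero    = []
  normals (suc n) = map (1# ∷_) (vectors n) ++ cartesianProductWith _∷_ nils (normals n)

  normals-complete : ∀ {n} {x : Vec Carrier n} → Normal x → x ∈ₗ normals n
  normals-complete (unit {x = x})   = ∈-++⁺ˡ (∈-map⁺ (1# ∷_) (∈-vectors x))
  normals-complete (nil aθ≡0 N) = ∈-++⁺ʳ (map (1# ∷_) (vectors _))
    (∈-cartesianProductWith⁺ _∷_ (∈-filter⁺ (λ a → a * θ ≟ 0#) (complete _) aθ≡0) (normals-complete N))

  normals-sound : ∀ n → All Normal (normals n)
  normals-sound zero    = []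
  normals-sound (suc n) = All.++⁺ (All.map⁺ (All.universal (λ _ → unit) (vectors n)))
    (All.cartesianProductWith⁺ (≡.setoid _) (≡.setoid _) _∷_ nils (normals n)
      (λ a∈nils x∈normals → nil (proj₂ (∈-filter⁻ (λ a → a * θ ≟ 0#) {xs = elements} a∈nils))
        (All.lookup (normals-sound n) x∈normals)))

  vectors-unique : ∀ n → Unique (vectors n)
  vectors-unique zero    = [] ∷ []
  vectors-unique (suc n) = Unique.cartesianProductWith⁺ _∷_ Vec.∷-injective unique (vectors-unique n)

  normals-unique : ∀ n → Unique (normals n)
  normals-unique zero    = []
  normals-unique (suc n) = Unique.++⁺
    (Unique.map⁺ Vec.∷-injectiveʳ (vectors-unique n))
    (Unique.cartesianProductWith⁺ _∷_ Vec.∷-injective (Unique.filter⁺ _ unique) (normals-unique n))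
    disjoint
    where
    disjoint : Disjoint (map (1# ∷_) (vectors n)) (cartesianProductWith _∷_ nils (normals n))
    disjoint (x∈units , x∈nils)
      with _ , _ , refl ← ∈-map⁻ (1# ∷_) x∈units
      with _ , _ , a∈nils , _ , eq ← ∈-cartesianProductWith⁻ _∷_ nils (normals n) x∈nils
      = ≈1⇒aθ≢0 (≈-reflexive (≡.sym (Vec.∷-injectiveˡ eq)))
          (proj₂ (∈-filter⁻ (λ a → a * θ ≟ 0#) {xs = elements} a∈nils))

  -- Counting with tables

  Op : Set
  Op = Table (Table Carrier)

  op : (Carrier → Carrier → Carrier) → Op
  op f = tabulate λ x → tabulate (f x)

  op-! : ∀ f x y → op f ! x ! y ≡ f x y
  op-! f x y = ≡.trans (cong (_! y) (tabulate-! _ x)) (tabulate-! (f x) y)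

  -- The coordinates of the form are given by their rows in the multiplication table.
  dot : Op → ∀ {n} → Vec (Table Carrier) n → Vec Carrier n → Carrier
  dot ⊞ []           []           = 0#
  dot ⊞ (r ∷ [])     (x ∷ [])     = r ! x
  dot ⊞ (r ∷ s ∷ rs) (x ∷ y ∷ p)  = ⊞ ! (r ! x) ! dot ⊞ (s ∷ rs) (y ∷ p)

  dot≈∙ : ∀ {n} (l p : Vec Carrier n) →
          dot (op _+_) (Vec.map (op _*_ !_) l) p ≈ Vec.lookup l ∙ Vec.lookup p
  dot≈∙ []          []          = ≈-refl
  dot≈∙ (a ∷ [])    (x ∷ [])    = ≈-trans (≈-reflexive (op-! _*_ a x)) (≈-sym (+-identityʳ _))
  dot≈∙ (a ∷ b ∷ l) (x ∷ y ∷ p) = ≈-trans (≈-reflexive (op-! _+_ _ _))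
    (+-cong (≈-reflexive (op-! _*_ a x)) (dot≈∙ (b ∷ l) (y ∷ p)))

  zeros : Table Bool
  zeros = tabulate λ x → does (x ≟ 0#)

  -- The tables and the rows of the form are arguments, so they are shared by all the vectors in
  -- `ps`.
  count : Table Bool → Op → ∀ {n} → List (Vec Carrier n) → Vec (Table Carrier) n → ℕ
  count z ⊞ ps l = length (filterᵇ (λ p → z ! dot ⊞ l p) ps)

  boundedBy : Table Bool → Op → Op → ∀ {n} → List (Vec Carrier n) → ℕ → Bool
  boundedBy z ⊞ ⊠ {n} ps k = all (λ l → count z ⊞ ps (Vec.map (⊠ !_) l) ≤ᵇ k) (normals n)

  -- Points, lines and arcs

  point : ∀ {p} → Normal p → Point
  point {p} N = record
    { Mem       = λ x → ∃ λ a → ∀ i → x i ≈ Vec.lookup p i * a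
    ; resp      = λ x≈y (a , x≈pa) → a , λ i → ≈-trans (≈-sym (x≈y i)) (x≈pa i)
    ; 0-closed  = 0# , λ i → ≈-sym (zeroʳ _)
    ; +-closed  = λ (a , x≈pa) (b , y≈pb) →
        a + b , λ i → ≈-trans (+-cong (x≈pa i) (y≈pb i)) (≈-sym (distribˡ _ a b))
    ; *ᵣ-closed = λ (a , x≈pa) b → a * b , λ i → ≈-trans (*-congʳ (x≈pa i)) (*-assoc _ a b)
    } , (λ _ → Vec.lookup p) , record
    { member      = λ _ → 1# , λ i → ≈-sym (*-identityʳ _)
    ; spanning    = λ (a , x≈pa) → (λ _ → a) , λ i → ≈-trans (x≈pa i) (≈-sym (+-identityʳ _))
    ; independent = λ { a pa≈0 zero → multiple≈0⇒≈0 N (λ i → ≈-trans (≈-sym (+-identityʳ _)) (pa≈0 i)) }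
    }

  annihilates-sum : ∀ (l : Vector Carrier 3) {n} (b : Vector R³.Carrierᴹ n) (a : Vector Carrier n) →
                    (∀ j → l ∙ b j ≈ 0#) → l ∙ R³-sum (λ j → b j R³.*ᵣ a j) ≈ 0#
  annihilates-sum l {zero}  b a lb≈0 = sum-≈0 (λ i → l i * 0#) (λ i → zeroʳ (l i))
  annihilates-sum l {suc n} b a lb≈0 = begin
    l ∙ (λ i → b zero i * a zero + R³-sum (λ j → b (suc j) R³.*ᵣ a (suc j)) i)
      ≈⟨ ∙-distribˡ l (λ i → b zero i * a zero) (R³-sum (λ j → b (suc j) R³.*ᵣ a (suc j))) ⟩
    l ∙ (λ i → b zero i * a zero) + l ∙ R³-sum (λ j → b (suc j) R³.*ᵣ a (suc j))
      ≈⟨ +-cong (∙-assocʳ l (b zero) (a zero)) (annihilates-sum l (b ∘ suc) (a ∘ suc) (lb≈0 ∘ suc)) ⟩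
    l ∙ b zero * a zero + 0#
      ≈⟨ ≈-trans (+-identityʳ _) (≈-trans (*-congʳ (lb≈0 zero)) (zeroˡ _)) ⟩
    0# ∎

  -- A form that annihilates the two basis vectors annihilates their span. Since an arc asks for an
  -- upper bound, inclusion of the line in the kernel suffices.
  line-form : (L : Line) → ∃ λ (l : Vec Carrier 3) → Normal l ×
              (∀ {x} → Submodule.Mem (proj₁ L) x → Vec.lookup l ∙ x ≈ 0#)
  line-form (L , b , basis)
    with l , l-unimodular , lb≈0 ← annihilator 2 b
    with u , N ← normalise l l-unimodular
    = Vec.tabulate (λ i → u * l i) , N , λ {x} x∈L → let a , x≈ba = IsBasis.spanning basis x∈L in begin
        Vec.lookup (Vec.tabulate (λ i → u * l i)) ∙ x
          ≈⟨ ∙-cong (λ i → ≈-reflexive (Vec.lookup∘tabulate (λ i → u * l i) i)) x≈ba ⟩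
        (λ i → u * l i) ∙ R³-sum (λ j → b j R³.*ᵣ a j)
          ≈⟨ ∙-assocˡ u l (R³-sum (λ j → b j R³.*ᵣ a j)) ⟩
        u * l ∙ R³-sum (λ j → b j R³.*ᵣ a j)
          ≈⟨ *-congˡ (annihilates-sum l b a lb≈0) ⟩
        u * 0#
          ≈⟨ zeroʳ u ⟩
        0# ∎

  arc : ∀ {ps k} → All Normal ps → Unique ps → T (boundedBy zeros (op _+_) (op _*_) ps k) →
        ProjectiveArc (length ps) k
  arc {ps} {k} ps-normal ps-unique ps-bounded = record
    { points   = λ i → point (normal i)
    ; distinct = λ {i} {j} (i⊆j , j⊆i) →
        let a , pᵢ≈pⱼa = i⊆j (generator i)
            b , pⱼ≈pᵢb = j⊆i (generator j)
        in lookup-injective ps-unique (normal-unique (normal i) (normal j) pᵢ≈pⱼa pⱼ≈pᵢb)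
    ; bounded  = λ L S S⊆L → let l , l-normal , lL≈0 = line-form L in
        ≤-trans
          -- A point on `L` has its generator in `L`, so the count for the form `l` includes it; the
          -- form itself occurs in `normals 3`, where all counts have been checked.
          (∣S∣≤length-filterᵇ _ ps S λ {i} i∈S → incident l (lookup ps i) (lL≈0 (S⊆L i∈S (generator i))))
          (≤ᵇ⇒≤ _ k (All.lookup (All.all⁺ _ (normals 3) ps-bounded) (normals-complete l-normal)))
    }
    where
    normal : ∀ i → Normal (lookup ps i)
    normal i = All.lookup ps-normal (∈-lookup i)

    generator : ∀ i → ∃ λ a → ∀ j → Vec.lookup (lookup ps i) j ≈ Vec.lookup (lookup ps i) j * a
    generator i = 1# , λ j → ≈-sym (*-identityʳ _)

    incident : ∀ l p → Vec.lookup l ∙ Vec.lookup p ≈ 0# →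
               zeros ! dot (op _+_) (Vec.map (op _*_ !_) l) p ≡ true
    incident l p lp≈0 =
      ≡.trans (tabulate-! _ _) (dec-true (_ ≟ 0#) (≈⇒≡ (≈-trans (dot≈∙ l p) lp≈0)))

  -- Only the size and the bound are left to evaluation, as equations closed by `refl`. Normality
  -- and uniqueness are inherited from `normals 3` by every mask.
  select-arc : ∀ m {k n} → (length (select m (normals 3)) ≡ᵇ k) ≡ true →
               boundedBy zeros (op _+_) (op _*_) (select m (normals 3)) n ≡ true → ProjectiveArc k n
  select-arc m {k} {n} size bound = subst (λ k → ProjectiveArc k n) (≡ᵇ⇒≡ _ k (Bool.T-≡ .from size))
    (arc (select⁺ m (normals-sound 3)) (select-unique m (normals-unique 3)) (Bool.T-≡ .from bound))

-- The three chain rings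

module _ (R : Ring 0ℓ 0ℓ) (F : Finite (Ring.Carrier R)) where
  open Ring R
  open Finite F

  unit⊎nil? : ∀ θ → Dec (∀ a → (∃ λ b → b * a ≡ 1#) ⊎ a * θ ≡ 0#)
  unit⊎nil? θ = ∀? λ a → ∃? (λ b → b * a ≟ 1#) ⊎-dec (a * θ ≟ 0#)

  chain? : Dec (∀ a b → (∃ λ c → a ≡ c * b) ⊎ (∃ λ c → b ≡ c * a))
  chain? = ∀? λ a → ∀? λ b → ∃? (λ c → a ≟ c * b) ⊎-dec ∃? (λ c → b ≟ c * a)

ℤ₄²-finite : Finite (Fin 4 × Fin 4)
ℤ₄²-finite = Fin-finite 4 ×-finite Fin-finite 4

𝔽₄²-finite : Finite ((Bool × Bool) × (Bool × Bool))
𝔽₄²-finite = (Bool-finite ×-finite Bool-finite) ×-finite (Bool-finite ×-finite Bool-finite)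

𝔾₄-chain : IsChainRing 𝔾₄
𝔾₄-chain = record
  { ≈⇒≡      = λ (p , q) → cong₂ _,_ p q
  -- The element 2, whose left annihilator is the maximal ideal.
  ; θ        = 2F , 0F
  ; θ≢0      = λ ()
  ; unit⊎nil = witness (unit⊎nil? 𝔾₄ ℤ₄²-finite (2F , 0F)) refl
  ; chain    = witness (chain? 𝔾₄ ℤ₄²-finite) refl
  }

𝕊₄-chain : IsChainRing 𝕊₄
𝕊₄-chain = record
  { ≈⇒≡      = λ ((p , q) , (r , s)) → cong₂ _,_ (cong₂ _,_ p q) (cong₂ _,_ r s)
  -- The class of X: constant term 0 and coefficient 1, where `(true , false)` is the 1 of `𝔽₄`.
  ; θ        = (false , false) , (true , false)
  ; θ≢0      = λ ()
  ; unit⊎nil = witness (unit⊎nil? 𝕊₄ 𝔽₄²-finite ((false , false) , (true , false))) refl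
  ; chain    = witness (chain? 𝕊₄ 𝔽₄²-finite) refl
  }

𝕋₄-chain : IsChainRing 𝕋₄
𝕋₄-chain = record
  { ≈⇒≡      = λ ((p , q) , (r , s)) → cong₂ _,_ (cong₂ _,_ p q) (cong₂ _,_ r s)
  -- Again the class of X. Multiplying a + bX by it on the right gives aX, so exactly the elements
  -- with a = 0 kill it.
  ; θ        = (false , false) , (true , false)
  ; θ≢0      = λ ()
  ; unit⊎nil = witness (unit⊎nil? 𝕋₄ 𝔽₄²-finite ((false , false) , (true , false))) refl
  ; chain    = witness (chain? 𝕋₄ 𝔽₄²-finite) refl
  }

-- Explicit arcs over the three rings

-- The bit masks refer to the order of normals 3.  They were found by a computer
-- search among the unions of orbits of small groups of collineations (the 120
-- points over 𝔾₄ are part of a (126,8)-arc that is such a union).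
theorem3p6 : (R : Ring 0ℓ 0ℓ) → R ≡ 𝔾₄ ⊎ R ≡ 𝕊₄ ⊎ R ≡ 𝕋₄ →
    PHG.ProjectiveArc R 120 8 × PHG.ProjectiveArc R 140 9 × PHG.ProjectiveArc R 152 10
theorem3p6 _ (inj₁ refl) =
  Arcs.select-arc 𝔾₄ ℤ₄²-finite 𝔾₄-chain
    0x10010075805a9066441ec491f40b2383676283d907a2943b61c1f00a93691718000017e206590000603a
    refl refl ,
  Arcs.select-arc 𝔾₄ ℤ₄²-finite 𝔾₄-chain
    0xc40b73b047340b7cb0470040d48c1000267441cb6a313b11c49aaaba2476eaaadc84416b306e9b119bc0
    refl refl ,
  Arcs.select-arc 𝔾₄ ℤ₄²-finite 𝔾₄-chain
    0x6333999993969636c3c9e0ea75d5101a20808d7818e72dd818e7101a8020e0ead575dd28e8177d88e817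
    refl refl
theorem3p6 _ (inj₂ (inj₁ refl)) =
  Arcs.select-arc 𝕊₄ 𝔽₄²-finite 𝕊₄-chain
    0x69a039950c9950c69a03c60ac905c905c60a00ff000000ff0000356035603a903a900c6a039a0c950365
    refl refl ,
  Arcs.select-arc 𝕊₄ 𝔽₄²-finite 𝕊₄-chain
    0xf0000000ff0ff00f00f0f0f0000ff00c33c3c3c3333cc3369969696999966995aa5a5a5aaaa55aa
    refl refl ,
  Arcs.select-arc 𝕊₄ 𝔽₄²-finite 𝕊₄-chain
    0x566c5a69caa66ca569c55a53aa53aa5c5a5c030cf303030cf30390a390ac60ac60a3c999c99939663966
    refl refl
theorem3p6 _ (inj₂ (inj₂ refl)) =
  Arcs.select-arc 𝕋₄ 𝔽₄²-finite 𝕋₄-chain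
    0xa095950659a0956506563360cc60c3603c60f000f000000f000f0c690c6603690366ca0cca03350c3503
    refl refl ,
  Arcs.select-arc 𝕋₄ 𝔽₄²-finite 𝕋₄-chain
    0x9c623636436c61c9368c2993499c196c896300f4f002f00800f1c23a343531c5c8ca3943c923398cc91c
    refl refl ,
  Arcs.select-arc 𝕋₄ 𝔽₄²-finite 𝕋₄-chain
    0xc5ca6c5ca6353a6353a65936a636a9c656c603f003f0fc00fc00c356cc5633a63ca6cf603f603090c090
    refl refl
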